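{- There exists an absolute constant $C>0$ such that the following holds for all $n\geq 3$. Let $\mathfrak{X}=(\Omega,S)$ be a scheme on $n=|\Omega|$ points and let $a\in S^\cup$ be a connected relation such that $aa^*=a^*a$. Then \[ \overrightarrow{\mathrm{diam}}(a)\leq C\cdot\mathrm{diam}(a)\log\log n, \] i.e. $\overrightarrow{\mathrm{diam}}(a)=O(\mathrm{diam}(a)\log\log n)$.
   Context: Let $\Omega$ be a finite set. For relations $a,b\subseteq\Omega\times\Omega$ the product is $ab=\{(\alpha,\beta)\mid(\alpha,\gamma)\in a,\ (\gamma,\beta)\in b\text{ for some }\gamma\in\Omega\}$, the transpose is $a^*=\{(\beta,\alpha)\mid(\alpha,\beta)\in a\}$, and $1_\Omega=\{(\alpha,\alpha)\mid\alpha\in\Omega\}$. A scheme (homogeneous coherent configuration) is a pair $\mathfrak{X}=(\Omega,S)$ where $S$ is a partition of $\Omega\times\Omega$ into relations such that: (1) $1_\Omega\in S$; (2) if $a\in S$ then $a^*\in S$; (3) for any $a,b,c\in S$ the number $|\{\gamma\in\Omega\mid(\alpha,\gamma)\in b,\ (\gamma,\beta)\in c\}|$ does not depend on the choice of $(\alpha,\beta)\in a$. $S^\cup$ denotes the set of all unions of relations from $S$. Relations on $\Omega$ are viewed as directed graphs on the vertex set $\Omega$. The directed diameter $\overrightarrow{\mathrm{diam}}(a)$ is the maximum over ordered pairs of vertices of the length of a shortest path respecting edge orientations; the undirected diameter is $\mathrm{diam}(a)=\overrightarrow{\mathrm{diam}}(a\cup a^*)$. Connected means that any two vertices are joined by a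 path ignoring orientations; for $a\in S^\cup$ this is equivalent to strong connectivity, so the directed diameter is finite. $\log$ is the base-2 logarithm. -}

module Defs where

open import Level using (0ℓ)
open import Data.Nat using (ℕ; zero; suc; _*_; _^_; _≤_; _<_; _>_)
open import Data.Fin using (Fin)
open import Data.Fin.Properties using (_≟_)
open import Data.Fin.Subset using (Subset; _∈_)
open import Data.List using (filter; length; tabulate)
open import Data.Product using (∃; ∃₂; _×_; proj₁; proj₂)
open import Function using (flip; _↔_; module Inverse)
open import Relation.Binary.Core using (Rel; _⇔_)
open import Relation.Binary.Definitions using (Decidable)
open import Relation.Binary.Construct.Closure.Equivalence using (EqClosure)
open import Relation.Binary.Construct.Composition using () renaming (_;_ to _⨾_) public
open import Relation.Binary.Construct.Union using (_∪_)
open import Relation.Binary.PropositionalEquality using (_≡_; subst)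
import Relation.Unary as Unary
open import Relation.Nullary.Decidable using (_×-dec_; map′)

infixl 9 _*ᵣ

_*ᵣ : {Ω : Set} → Rel Ω 0ℓ → Rel Ω 0ℓ
a *ᵣ = flip a

card : {Ω : Set} {n : ℕ} → Ω ↔ Fin n → {P : Unary.Pred Ω 0ℓ} → Unary.Decidable P → ℕ
card enum P? = length (filter P? (tabulate (Inverse.from enum)))

-- The set S of relations is given as a family indexed by Fin rank.  Since
-- the classes are nonempty and pairwise disjoint, distinct indices name
-- distinct relations.  Equality of relations is extensional equality _⇔_.
record Partition (Ω : Set) : Set₁ where
  field
    rank     : ℕ
    class    : Fin rank → Rel Ω 0ℓ
    nonempty : ∀ i → ∃₂ λ α β → class i α β
    disjoint : ∀ {i j α β} → class i α β → class j α β → i ≡ j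
    cover    : ∀ α β → ∃ λ i → class i α β

  class? : ∀ i → Decidable (class i)
  class? i α β = map′
    (λ j≡i → subst (λ k → class k α β) j≡i (proj₂ (cover α β)))
    (disjoint (proj₂ (cover α β)))
    (proj₁ (cover α β) ≟ i)

record Scheme {Ω : Set} {n : ℕ} (enum : Ω ↔ Fin n) : Set₁ where
  field
    partition : Partition Ω

  open Partition partition public

  middlePoints : Fin rank → Fin rank → Ω → Ω → ℕ
  middlePoints j k α β = card enum (λ γ → class? j α γ ×-dec class? k γ β)

  field
    identity  : ∃ λ i → class i ⇔ _≡_
    transpose : ∀ i → ∃ λ j → class j ⇔ (class i *ᵣ)
    regular   : ∀ i j k {α β α′ β′} → class i α β → class i α′ β′ →
                middlePoints j k α β ≡ middlePoints j k α′ β′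

-- a ∈ S^∪
_∈∪_ : {Ω : Set} {n : ℕ} {enum : Ω ↔ Fin n} → Rel Ω 0ℓ → Scheme enum → Set
a ∈∪ 𝔛 = ∃ λ (I : Subset rank) → a ⇔ (λ α β → ∃ λ i → i ∈ I × class i α β)
  where open Scheme 𝔛

Connected : {Ω : Set} → Rel Ω 0ℓ → Set
Connected a = ∀ α β → EqClosure a α β

Walk : {Ω : Set} → Rel Ω 0ℓ → ℕ → Rel Ω 0ℓ
Walk a zero    = _≡_
Walk a (suc k) = a ⨾ Walk a k

-- A walk of minimum length is automatically a path.
IsDistance : {Ω : Set} → Rel Ω 0ℓ → Ω → Ω → ℕ → Set
IsDistance a α β k = Walk a k α β × (∀ j → Walk a j α β → k ≤ j)

IsDirectedDiameter : {Ω : Set} → Rel Ω 0ℓ → ℕ → Set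
IsDirectedDiameter a d =
  (∀ α β → ∃ λ k → IsDistance a α β k × k ≤ d) ×
  (∃₂ λ α β → IsDistance a α β d)

IsDiameter : {Ω : Set} → Rel Ω 0ℓ → ℕ → Set
IsDiameter a = IsDirectedDiameter (a ∪ a *ᵣ)

-- A nonnegative real number x is represented by its lower cut in the
-- nonnegative rationals: X p q, for q > 0, means p / q < x.
Cut : Set₁
Cut = ℕ → ℕ → Set

fromℕ : ℕ → Cut
fromℕ m p q = p < m * q

-- The base-2 logarithm, for x ≥ 1:  p / q < log₂ x  iff  2^(p/q) < s / t < x
-- for some rational s / t, and 2^(p/q) < s / t iff 2^p t^q < s^q.
log₂ : Cut → Cut
log₂ X p q = ∃₂ λ s t → t > 0 × X s t × 2 ^ p * t ^ q < s ^ q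

-- d ≤ k · x, i.e. every nonnegative rational p / q with k (p / q) < d
-- satisfies p / q < x.
_≤_·_ : ℕ → ℕ → Cut → Set
d ≤ k · X = ∀ p q → q > 0 → k * p < d * q → X p q

{-# OPTIONS --safe #-}

-- Let D be the undirected diameter and B k the relation "reachable along a
-- in at most k D steps".  As a and a* commute, an undirected walk splits into
-- a walk along a followed by one against a, so (B 1)(B 1)* is complete.  All
-- these relations are unions of classes, hence have constant degrees, and
-- Ruzsa's triangle inequality gives n deg(B k) ≤ deg(B (k + 1))².  Thus
-- deg(B k) ≥ n^(1 - 2^-k), which exceeds n / 2 once n < 2^(2^k); two
-- neighbourhoods of that size meet, so B (2k) is complete.

module Submission where

open import Defs
open import Level using (0ℓ)
open import Data.Bool using (true; false; if_then_else_)
open import Data.Nat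
  using (ℕ; zero; suc; _+_; _*_; _^_; _≤_; _<_; _>_; _≥_; z≤n; s≤s; NonZero; >-nonZero)
open import Data.Nat.Properties hiding (_≟_)
open import Data.Nat.Solver using (module +-*-Solver)
open import Data.Fin using (Fin; zero; suc)
open import Data.Fin.Properties using (_≟_; any?)
open import Data.Fin.Subset as Subset using ()
open import Data.Fin.Subset.Properties using (_∈?_)
open import Data.List using (List; _∷_; filter; length; tabulate)
open import Data.List.Properties using (filter-some)
open import Data.List.Relation.Unary.All using (All; _∷_)
open import Data.List.Relation.Unary.All.Properties using (all-filter)
open import Data.List.Relation.Unary.Any.Properties using (tabulate⁺)
open import Data.Product using (∃; ∃₂; _×_; _,_; proj₁; proj₂)
open import Data.Sum using (inj₁; inj₂)
open import Function using (_∘_; flip; _↔_; module Inverse)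
open import Relation.Binary.Core using (Rel; _⇒_; _⇔_)
open import Relation.Binary.Definitions using (Decidable)
open import Relation.Binary.Construct.Closure.Equivalence using (EqClosure)
open import Relation.Binary.Construct.Closure.ReflexiveTransitive using (ε; _◅_)
open import Relation.Binary.Construct.Closure.Symmetric using (fwd; bwd)
open import Relation.Binary.Construct.Union using (_∪_)
open import Relation.Binary.PropositionalEquality
import Relation.Unary as Unary
open import Relation.Nullary using (Dec; yes; no; does; contradiction)
open import Relation.Nullary.Decidable using (_×-dec_; _⊎-dec_; map′)
open import Algebra.Properties.Semiring.Sum +-*-semiring
  using (sum; sum-cong-≗; ∑-comm; ∑-distrib-+; *-distribˡ-sum; *-distribʳ-sum)

-- Finite sums and indicators

sum-mono : ∀ {n} {f g : Fin n → ℕ} → (∀ i → f i ≤ g i) → sum f ≤ sum g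
sum-mono {zero}  f≤g = z≤n
sum-mono {suc n} f≤g = +-mono-≤ (f≤g zero) (sum-mono (f≤g ∘ suc))

sum-const : ∀ n x → sum {n} (λ _ → x) ≡ n * x
sum-const zero    x = refl
sum-const (suc n) x = cong (x +_) (sum-const n x)

-- Only `does` is inspected, so `map′` leaves the value unchanged definitionally; `sum-select` and
-- `degree-constant` rely on this.
⟦_⟧ : {P : Set} → Dec P → ℕ
⟦ P? ⟧ = if does P? then 1 else 0

⟦⟧-true : {P : Set} (P? : Dec P) → P → ⟦ P? ⟧ ≡ 1
⟦⟧-true (yes _) _ = refl
⟦⟧-true (no ¬p) p = contradiction p ¬p

⟦⟧-mono : {P Q : Set} (P? : Dec P) (Q? : Dec Q) → (P → Q) → ⟦ P? ⟧ ≤ ⟦ Q? ⟧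
⟦⟧-mono (no _)  _  _   = z≤n
⟦⟧-mono (yes p) Q? P→Q = ≤-reflexive (sym (⟦⟧-true Q? (P→Q p)))

⟦⟧-cong : {P Q : Set} (P? : Dec P) (Q? : Dec Q) → (P → Q) → (Q → P) → ⟦ P? ⟧ ≡ ⟦ Q? ⟧
⟦⟧-cong P? Q? P→Q Q→P = ≤-antisym (⟦⟧-mono P? Q? P→Q) (⟦⟧-mono Q? P? Q→P)

sum-select : ∀ {n} (c : Fin n) (f : Fin n → ℕ) → sum (λ i → ⟦ c ≟ i ⟧ * f i) ≡ f c
sum-select {suc n} zero f = begin
  1 * f zero + sum {n} (λ _ → 0)  ≡⟨ cong (1 * f zero +_) (sum-const n 0) ⟩
  1 * f zero + n * 0              ≡⟨ cong₂ _+_ (*-identityˡ (f zero)) (*-zeroʳ n) ⟩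
  f zero + 0                      ≡⟨ +-identityʳ (f zero) ⟩
  f zero                          ∎
  where open ≡-Reasoning
sum-select (suc c) f = sum-select c (f ∘ suc)

length-filter-tabulate : {A : Set} {P : Unary.Pred A 0ℓ} (P? : Unary.Decidable P) →
  ∀ {n} (f : Fin n → A) → length (filter P? (tabulate f)) ≡ sum (λ i → ⟦ P? (f i) ⟧)
length-filter-tabulate P? {zero}  f = refl
length-filter-tabulate P? {suc n} f with does (P? (f zero))
... | true  = cong suc (length-filter-tabulate P? (f ∘ suc))
... | false = length-filter-tabulate P? (f ∘ suc)

-- Extremal elements

least : {P : ℕ → Set} → Unary.Decidable P → ∀ k → P k → ∃ λ m → P m × (∀ j → P j → m ≤ j)
least P? zero    p = 0 , p , λ _ _ → z≤n
least P? (suc k) p with P? 0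
... | yes p₀ = 0 , p₀ , λ _ _ → z≤n
... | no ¬p₀ with m , pₘ , m-least ← least (P? ∘ suc) k p =
  suc m , pₘ , λ { zero p₀ → contradiction p₀ ¬p₀ ; (suc j) pⱼ → s≤s (m-least j pⱼ) }

argmax : ∀ {n} (f : Fin (suc n) → ℕ) → ∃ λ i → ∀ j → f j ≤ f i
argmax {zero}  f = zero , λ { zero → ≤-refl }
argmax {suc n} f with argmax (f ∘ suc)
... | i , max with ≤-total (f zero) (f (suc i))
...   | inj₁ f₀≤fᵢ = suc i , λ { zero → f₀≤fᵢ ; (suc j) → max j }
...   | inj₂ fᵢ≤f₀ = zero , λ { zero → ≤-refl ; (suc j) → ≤-trans (max j) fᵢ≤f₀ }

-- Walks

module _ {Ω : Set} {a : Rel Ω 0ℓ} where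

  walk-++ : ∀ i {j α β γ} → Walk a i α γ → Walk a j γ β → Walk a (i + j) α β
  walk-++ zero    refl         v = v
  walk-++ (suc i) (_ , s , w) v = _ , s , walk-++ i w v

  walk-snoc : ∀ k {α β γ} → Walk a k α γ → a γ β → Walk a (suc k) α β
  walk-snoc k {α} {β} w s = subst (λ m → Walk a m α β) (+-comm k 1) (walk-++ k w (_ , s , refl))

module _ {Ω : Set} {a : Rel Ω 0ℓ} where

  -- Loops encode "at most": a walk of length `m` in `a ∪ _≡_` amounts to a walk of length at most
  -- `m` along `a`, while lengths stay exact and add under concatenation.
  walk-reflexive : ∀ k {α} → Walk (a ∪ _≡_) k α α
  walk-reflexive zero    = refl
  walk-reflexive (suc k) = _ , inj₂ refl , walk-reflexive k

  walk-pad : ∀ {k m α β} → k ≤ m → Walk (a ∪ _≡_) k α β → Walk (a ∪ _≡_) m α β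
  walk-pad {m = m} z≤n refl   = walk-reflexive m
  walk-pad (s≤s k≤m) (_ , s , w) = _ , s , walk-pad k≤m w

  walk-unpad : ∀ m {α β} → Walk (a ∪ _≡_) m α β → ∃ λ k → k ≤ m × Walk a k α β
  walk-unpad zero    w = 0 , z≤n , w
  walk-unpad (suc m) (_ , inj₁ s , w) with k , k≤m , v ← walk-unpad m w =
    suc k , s≤s k≤m , _ , s , v
  walk-unpad (suc m) (_ , inj₂ refl , w) with k , k≤m , v ← walk-unpad m w =
    k , m≤n⇒m≤1+n k≤m , v

  EqClosure⇒Walk : ∀ {α β} → EqClosure a α β → ∃ λ k → Walk (a ∪ a *ᵣ) k α β
  EqClosure⇒Walk ε = 0 , refl
  EqClosure⇒Walk (fwd s ◅ t) with k , w ← EqClosure⇒Walk t = suc k , _ , inj₁ s , w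
  EqClosure⇒Walk (bwd s ◅ t) with k , w ← EqClosure⇒Walk t = suc k , _ , inj₂ s , w

  module _ (comm : ((a *ᵣ) ⨾ a) ⇒ (a ⨾ (a *ᵣ))) where

    -- The step against `a` moves past the forward steps one at a time, each exchange being one use
    -- of `comm`.
    walk-commute : ∀ m {α β γ} → (a *ᵣ) α γ → Walk (a ∪ _≡_) m γ β →
                   (Walk (a ∪ _≡_) m ⨾ ((a ∪ _≡_) *ᵣ)) α β
    walk-commute zero    s refl = _ , refl , inj₁ s
    walk-commute (suc m) s (_ , inj₂ refl , w) with _ , v , t ← walk-commute m s w =
      _ , (_ , inj₂ refl , v) , t
    walk-commute (suc m) s (_ , inj₁ r , w) with _ , r′ , s′ ← comm (_ , s , r)
      with _ , v , t ← walk-commute m s′ w = _ , (_ , inj₁ r′ , v) , t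

    -- Induction on the first step. A forward step goes in front of the first walk; a backward step
    -- is carried across that walk by `walk-commute` and extends the end of the second. A loop keeps
    -- the two lengths equal.
    undirected-walk-splits : ∀ k → Walk (a ∪ a *ᵣ) k ⇒
                             (Walk (a ∪ _≡_) k ⨾ (Walk (a ∪ _≡_) k *ᵣ))
    undirected-walk-splits zero    refl = _ , refl , refl
    undirected-walk-splits (suc k) (_ , inj₁ s , w)
      with _ , u , v ← undirected-walk-splits k w =
      _ , (_ , inj₁ s , u) , (_ , inj₂ refl , v)
    undirected-walk-splits (suc k) (_ , inj₂ s , w)
      with _ , u , v ← undirected-walk-splits k w
      with _ , u′ , s′ ← walk-commute k s u =
      _ , (_ , inj₂ refl , u′) , walk-snoc k v s′

-- Relations on an enumerated set

module Enumerated {Ω : Set} {n : ℕ} (enum : Ω ↔ Fin n) where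

  open Inverse enum using (to; from; strictlyInverseʳ)

  _≟Ω_ : Decidable {A = Ω} _≡_
  α ≟Ω β = map′
    (λ eq → trans (sym (strictlyInverseʳ α)) (trans (cong from eq) (strictlyInverseʳ β)))
    (cong to)
    (to α ≟ to β)

  anyΩ? : {P : Unary.Pred Ω 0ℓ} → Unary.Decidable P → Dec (∃ P)
  anyΩ? {P} P? = map′
    (λ (i , p) → from i , p)
    (λ (α , p) → to α , subst P (sym (strictlyInverseʳ α)) p)
    (any? (P? ∘ from))

  Walk? : {a : Rel Ω 0ℓ} → Decidable a → ∀ k → Decidable (Walk a k)
  Walk? a? zero    = _≟Ω_
  Walk? a? (suc k) α β = anyΩ? (λ γ → a? α γ ×-dec Walk? a? k γ β)

  ∑Ω : (Ω → ℕ) → ℕ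
  ∑Ω f = sum (f ∘ from)

  degree : {R : Rel Ω 0ℓ} → Decidable R → Ω → ℕ
  degree R? α = ∑Ω (λ β → ⟦ R? α β ⟧)

  Regular : {R : Rel Ω 0ℓ} → Decidable R → ℕ → Set
  Regular R? r = ∀ α → degree R? α ≡ r

  ∑Ω-degree : {R : Rel Ω 0ℓ} (R? : Decidable R) {r : ℕ} → Regular R? r →
              ∑Ω (degree R?) ≡ n * r
  ∑Ω-degree R? {r} reg = trans (sum-cong-≗ (reg ∘ from)) (sum-const n r)

  -- The pairs of `R` are counted once by source and once by target.
  in-degree≡out-degree : .{{_ : NonZero n}} {R : Rel Ω 0ℓ} (R? : Decidable R) {r s : ℕ} →
                         Regular R? r → Regular (flip R?) s → s ≡ r
  in-degree≡out-degree R? {r} {s} out inn = *-cancelˡ-≡ s r n (begin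
    n * s                  ≡⟨ ∑Ω-degree (flip R?) inn ⟨
    ∑Ω (degree (flip R?))  ≡⟨ ∑-comm (λ i j → ⟦ R? (from j) (from i) ⟧) ⟩
    ∑Ω (degree R?)         ≡⟨ ∑Ω-degree R? out ⟩
    n * r                  ∎)
    where open ≡-Reasoning

  card≡∑Ω : {P : Unary.Pred Ω 0ℓ} (P? : Unary.Decidable P) →
            card enum P? ≡ ∑Ω (λ α → ⟦ P? α ⟧)
  card≡∑Ω P? = length-filter-tabulate P? from

  card-positive : {P : Unary.Pred Ω 0ℓ} (P? : Unary.Decidable P) → ∃ P → 0 < card enum P?
  card-positive {P} P? (α , p) =
    filter-some P? (tabulate⁺ (to α) (subst P (sym (strictlyInverseʳ α)) p))

  card-witness : {P : Unary.Pred Ω 0ℓ} (P? : Unary.Decidable P) → 0 < card enum P? → ∃ P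
  card-witness {P} P? 0<card = head-witness (filter P? (tabulate from)) (all-filter P? (tabulate from)) 0<card
    where
    head-witness : (αs : List Ω) → All P αs → 0 < length αs → ∃ P
    head-witness (α ∷ _) (p ∷ _) _ = α , p

  -- Double counting of the pairs (δ , β) with α E δ F β, for a fixed α: each
  -- β has at least deg B of them, namely the B-neighbours δ of a middle
  -- point γ of α A γ C β.
  ruzsa : {A B C E F : Rel Ω 0ℓ} (B? : Decidable B) (E? : Decidable E) (F? : Decidable F)
          {b e f : ℕ} → Regular B? b → Regular E? e → Regular F? f →
          (∀ α β → (A ⨾ C) α β) → (A ⨾ B) ⇒ E → ((B *ᵣ) ⨾ C) ⇒ F →
          Ω → n * b ≤ e * f
  ruzsa {A} {C = C} B? E? F? {b} {e} {f} B-reg E-reg F-reg AC AB⇒E B*C⇒F α = begin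
    n * b                                                ≡⟨ sum-const n b ⟨
    ∑Ω (λ _ → b)                                         ≤⟨ sum-mono (λ i → fibre (from i)) ⟩
    ∑Ω (λ β → ∑Ω (λ δ → ⟦ E? α δ ⟧ * ⟦ F? δ β ⟧))
      ≡⟨ ∑-comm (λ i j → ⟦ E? α (from j) ⟧ * ⟦ F? (from j) (from i) ⟧) ⟩
    ∑Ω (λ δ → ∑Ω (λ β → ⟦ E? α δ ⟧ * ⟦ F? δ β ⟧))
      ≡⟨ sum-cong-≗ (λ j → trans
           (sym (*-distribˡ-sum ⟦ E? α (from j) ⟧ (λ i → ⟦ F? (from j) (from i) ⟧)))
           (cong (⟦ E? α (from j) ⟧ *_) (F-reg (from j)))) ⟩
    ∑Ω (λ δ → ⟦ E? α δ ⟧ * f)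
      ≡⟨ *-distribʳ-sum f (λ j → ⟦ E? α (from j) ⟧) ⟨
    degree E? α * f                                      ≡⟨ cong (_* f) (E-reg α) ⟩
    e * f                                                ∎
    where
    open ≤-Reasoning
    fibre : ∀ β → b ≤ ∑Ω (λ δ → ⟦ E? α δ ⟧ * ⟦ F? δ β ⟧)
    fibre β with γ , αγ , γβ ← AC α β = begin
      b            ≡⟨ B-reg γ ⟨
      degree B? γ  ≤⟨ sum-mono (λ i → edge (from i)) ⟩
      ∑Ω (λ δ → ⟦ E? α δ ⟧ * ⟦ F? δ β ⟧) ∎
      where
      edge : ∀ δ → ⟦ B? γ δ ⟧ ≤ ⟦ E? α δ ⟧ * ⟦ F? δ β ⟧
      edge δ with B? γ δ
      ... | no _   = z≤n
      ... | yes γδ = ≤-reflexive (sym (cong₂ _*_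
        (⟦⟧-true (E? α δ) (AB⇒E (γ , αγ , γδ)))
        (⟦⟧-true (F? δ β) (B*C⇒F (γ , γδ , γβ)))))

  -- The `r` successors of `α` and the `r` predecessors of `β` cannot be disjoint among fewer than
  -- `r + r` points.
  pigeonhole : {R : Rel Ω 0ℓ} (R? : Decidable R) {r : ℕ} →
               Regular R? r → Regular (flip R?) r → n < r + r → ∀ α β → (R ⨾ R) α β
  pigeonhole R? {r} out inn n<2r α β with anyΩ? (λ γ → R? α γ ×-dec R? γ β)
  ... | yes αβ = αβ
  ... | no ¬αβ = contradiction n<2r (≤⇒≯ (begin
    r + r                                     ≡⟨ cong₂ _+_ (out α) (inn β) ⟨
    degree R? α + degree (flip R?) β
      ≡⟨ ∑-distrib-+ (λ i → ⟦ R? α (from i) ⟧) (λ i → ⟦ R? (from i) β ⟧) ⟨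
    ∑Ω (λ γ → ⟦ R? α γ ⟧ + ⟦ R? γ β ⟧)        ≤⟨ sum-mono (λ i → at-most-one (from i)) ⟩
    ∑Ω (λ _ → 1)                              ≡⟨ sum-const n 1 ⟩
    n * 1                                     ≡⟨ *-identityʳ n ⟩
    n                                         ∎))
    where
    open ≤-Reasoning
    at-most-one : ∀ γ → ⟦ R? α γ ⟧ + ⟦ R? γ β ⟧ ≤ 1
    at-most-one γ with R? α γ | R? γ β
    ... | yes αγ | yes γβ = contradiction (γ , αγ , γβ) ¬αβ
    ... | yes _  | no _   = ≤-refl
    ... | no _   | yes _  = ≤-refl
    ... | no _   | no _   = z≤n

-- `least` turns walks into distances, and the maximum over pairs is found as the largest
-- eccentricity; `Fin (suc m)` is nonempty, as `argmax` demands.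
directedDiameter : {Ω : Set} {m : ℕ} (enum : Ω ↔ Fin (suc m)) {R : Rel Ω 0ℓ} → Decidable R →
                   (∀ α β → ∃ λ k → Walk R k α β) → ∃ (IsDirectedDiameter R)
directedDiameter {Ω} {m} enum {R} R? walks =
  dist (from i) (from (far i)) ,
  (λ α β → dist α β , isDistance α β , bound α β) ,
  from i , from (far i) , isDistance _ _
  where
  open Enumerated enum
  open Inverse enum using (to; from; strictlyInverseʳ)

  shortest : ∀ α β → ∃ (IsDistance R α β)
  shortest α β with k , w ← walks α β = least (λ j → Walk? R? j α β) k w

  dist : Ω → Ω → ℕ
  dist α β = proj₁ (shortest α β)

  isDistance : ∀ α β → IsDistance R α β (dist α β)
  isDistance α β = proj₂ (shortest α β)

  farthest : ∀ i → ∃ λ j → ∀ j′ → dist (from i) (from j′) ≤ dist (from i) (from j)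
  farthest i = argmax (λ j → dist (from i) (from j))

  far : Fin (suc m) → Fin (suc m)
  far i = proj₁ (farthest i)

  eccentric : ∃ λ i → ∀ i′ → dist (from i′) (from (far i′)) ≤ dist (from i) (from (far i))
  eccentric = argmax (λ i → dist (from i) (from (far i)))

  i : Fin (suc m)
  i = proj₁ eccentric

  bound : ∀ α β → dist α β ≤ dist (from i) (from (far i))
  bound α β = subst₂ (λ α β → dist α β ≤ dist (from i) (from (far i)))
    (strictlyInverseʳ α) (strictlyInverseʳ β)
    (≤-trans (proj₂ (farthest (to α)) (to β)) (proj₂ eccentric (to α)))

-- Invariant relations of a scheme

module Invariance {Ω : Set} {n : ℕ} {enum : Ω ↔ Fin n} (𝔛 : Scheme enum) where

  open Scheme 𝔛
  open Enumerated enum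
  open Inverse enum using (from)

  -- These are the unions of classes, phrased so that closure under products and walks can be shown
  -- without naming the set of classes.
  Invariant : Rel Ω 0ℓ → Set
  Invariant R = ∀ {i α β α′ β′} → class i α β → class i α′ β′ → R α β → R α′ β′

  ∈∪-invariant : {a : Rel Ω 0ℓ} → a ∈∪ 𝔛 → Invariant a
  ∈∪-invariant (I , a⇒I , I⇒a) {i} c c′ αβ with j , j∈I , cⱼ ← a⇒I αβ =
    I⇒a (i , subst (λ k → k Subset.∈ I) (disjoint cⱼ c) j∈I , c′)

  ∈∪-decidable : {a : Rel Ω 0ℓ} → a ∈∪ 𝔛 → Decidable a
  ∈∪-decidable (I , a⇒I , I⇒a) α β =
    map′ I⇒a a⇒I (any? (λ i → (i ∈? I) ×-dec class? i α β))

  ≡-invariant : Invariant _≡_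
  ≡-invariant {i} c c′ refl with e , e⇒≡ , ≡⇒e ← identity =
    e⇒≡ (subst (λ k → class k _ _) (disjoint c (≡⇒e refl)) c′)

  ∪-invariant : {R Q : Rel Ω 0ℓ} → Invariant R → Invariant Q → Invariant (R ∪ Q)
  ∪-invariant R-inv Q-inv c c′ (inj₁ r) = inj₁ (R-inv c c′ r)
  ∪-invariant R-inv Q-inv c c′ (inj₂ q) = inj₂ (Q-inv c c′ q)

  *ᵣ-invariant : {R : Rel Ω 0ℓ} → Invariant R → Invariant (R *ᵣ)
  *ᵣ-invariant R-inv {i} c c′ r with _ , _ , t ← transpose i = R-inv (t c) (t c′) r

  -- A middle point determines classes `i` and `j`. By `regular` the number of middle points of this
  -- type is the same, hence positive, at the second pair, and any of them serves.
  ⨾-invariant : {R Q : Rel Ω 0ℓ} → Invariant R → Invariant Q → Invariant (R ⨾ Q)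
  ⨾-invariant R-inv Q-inv {l} {α} {β} {α′} {β′} c c′ (γ , r , q)
    with i , cᵢ ← cover α γ | j , cⱼ ← cover γ β
    with γ′ , cᵢ′ , cⱼ′ ← card-witness (λ γ → class? i α′ γ ×-dec class? j γ β′)
      (subst (0 <_) (regular l i j c c′) (card-positive _ (γ , cᵢ , cⱼ))) =
    γ′ , R-inv cᵢ cᵢ′ r , Q-inv cⱼ cⱼ′ q

  Walk-invariant : {R : Rel Ω 0ℓ} → Invariant R → ∀ k → Invariant (Walk R k)
  Walk-invariant R-inv zero    = ≡-invariant
  Walk-invariant R-inv (suc k) = ⨾-invariant R-inv (Walk-invariant R-inv k)

  -- A valency is an intersection number on the diagonal: the middle points from `α` back to `α`
  -- through class `i` and its transpose are exactly the `i`-neighbours of `α`.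
  degree-class : ∀ i α α′ → degree (class? i) α ≡ degree (class? i) α′
  degree-class i α α′ with e , _ , ≡⇒e ← identity | j , j⇒ , ⇒j ← transpose i = begin
    degree (class? i) α    ≡⟨ middle α ⟨
    middlePoints i j α α   ≡⟨ regular e i j (≡⇒e refl) (≡⇒e refl) ⟩
    middlePoints i j α′ α′ ≡⟨ middle α′ ⟩
    degree (class? i) α′   ∎
    where
    open ≡-Reasoning
    middle : ∀ α → middlePoints i j α α ≡ degree (class? i) α
    middle α = trans (card≡∑Ω (λ γ → class? i α γ ×-dec class? j γ α)) (sum-cong-≗ (λ k →
      ⟦⟧-cong (class? i α (from k) ×-dec class? j (from k) α) (class? i α (from k))
        proj₁ (λ c → c , ⇒j c)))

  -- The degree is the sum of the valencies of the classes contained in `R`, and each valency is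
  -- constant.
  degree-constant : {R : Rel Ω 0ℓ} (R? : Decidable R) → Invariant R →
                    ∀ α α′ → degree R? α ≡ degree R? α′
  degree-constant {R} R? R-inv α α′ = begin
    degree R? α                                   ≡⟨ by-class α ⟩
    sum (λ i → degree (class? i) α * contains i)  ≡⟨ sum-cong-≗ (λ i → cong (_* contains i) (degree-class i α α′)) ⟩
    sum (λ i → degree (class? i) α′ * contains i) ≡⟨ by-class α′ ⟨
    degree R? α′                                  ∎
    where
    open ≡-Reasoning
    -- By invariance, the one pair supplied by `nonempty` decides for the whole class.
    contains : Fin rank → ℕ
    contains i with β , γ , _ ← nonempty i = ⟦ R? β γ ⟧

    contains-cover : ∀ α β → contains (proj₁ (cover α β)) ≡ ⟦ R? α β ⟧
    contains-cover α β with i , c ← cover α β with α₀ , β₀ , c₀ ← nonempty i =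
      ⟦⟧-cong (R? α₀ β₀) (R? α β) (R-inv c₀ c) (R-inv c c₀)

    by-class : ∀ α → degree R? α ≡ sum (λ i → degree (class? i) α * contains i)
    by-class α = begin
      degree R? α
        -- `class? i α β` is by definition a test of `proj₁ (cover α β) ≟ i`, so `sum-select` picks
        -- out the class of the pair.
        ≡⟨ sum-cong-≗ (λ k → sym (trans
             (sum-select (proj₁ (cover α (from k))) contains) (contains-cover α (from k)))) ⟩
      ∑Ω (λ β → sum (λ i → ⟦ class? i α β ⟧ * contains i))
        ≡⟨ ∑-comm (λ k i → ⟦ class? i α (from k) ⟧ * contains i) ⟩
      sum (λ i → ∑Ω (λ β → ⟦ class? i α β ⟧ * contains i))
        ≡⟨ sum-cong-≗ (λ i → *-distribʳ-sum (contains i) (λ k → ⟦ class? i α (from k) ⟧)) ⟨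
      sum (λ i → degree (class? i) α * contains i) ∎

  invariant-regular : {R : Rel Ω 0ℓ} (R? : Decidable R) → Invariant R →
                      ∀ α → Regular R? (degree R? α)
  invariant-regular R? R-inv α α′ = degree-constant R? R-inv α′ α

  invariant-regular-flip : .{{_ : NonZero n}} {R : Rel Ω 0ℓ} (R? : Decidable R) → Invariant R →
                           ∀ α → Regular (flip R?) (degree R? α)
  invariant-regular-flip R? R-inv α α′ = trans
    (degree-constant (flip R?) (*ᵣ-invariant R-inv) α′ α)
    (in-degree≡out-degree R? (invariant-regular R? R-inv α)
      (invariant-regular (flip R?) (*ᵣ-invariant R-inv) α))

-- Degree growth

^-distribʳ-* : ∀ m n o → (m * n) ^ o ≡ m ^ o * n ^ o
^-distribʳ-* m n zero    = refl
^-distribʳ-* m n (suc o) = begin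
  m * n * (m * n) ^ o       ≡⟨ cong (m * n *_) (^-distribʳ-* m n o) ⟩
  m * n * (m ^ o * n ^ o)   ≡⟨ [m*n]*[o*p]≡[m*o]*[n*p] m n (m ^ o) (n ^ o) ⟩
  m * m ^ o * (n * n ^ o)   ∎
  where open ≡-Reasoning

m^2≡m*m : ∀ m → m ^ 2 ≡ m * m
m^2≡m*m m = cong (m *_) (*-identityʳ m)

^-double : ∀ m k → m ^ (2 * k) ≡ m ^ k * m ^ k
^-double m k = begin
  m ^ (2 * k)    ≡⟨ ^-*-assoc m 2 k ⟨
  (m ^ 2) ^ k    ≡⟨ cong (_^ k) (m^2≡m*m m) ⟩
  (m * m) ^ k    ≡⟨ ^-distribʳ-* m m k ⟩
  m ^ k * m ^ k  ∎
  where open ≡-Reasoning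

-- This is `w k ≥ n ^ (1 - 2 ^ -k)` with roots and division cleared.
square-growth : ∀ n (w : ℕ → ℕ) → w 0 > 0 → (∀ k → n * w k ≤ w (suc k) * w (suc k)) →
                ∀ k → n ^ (2 ^ k) ≤ w k ^ (2 ^ k) * n
square-growth n w w₀>0 grow zero = begin
  n ^ 1        ≡⟨ *-identityʳ n ⟩
  n            ≤⟨ m≤n*m n (w 0) {{>-nonZero w₀>0}} ⟩
  w 0 * n      ≡⟨ cong (_* n) (*-identityʳ (w 0)) ⟨
  w 0 ^ 1 * n  ∎
  where open ≤-Reasoning
square-growth n w w₀>0 grow (suc k) = begin
  n ^ (2 * e)                    ≡⟨ ^-double n e ⟩
  -- Only one factor is estimated; the other joins `w k ^ e` to form `(n * w k) ^ e`, where `grow`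
  -- applies.
  n ^ e * n ^ e                  ≤⟨ *-monoʳ-≤ (n ^ e) (square-growth n w w₀>0 grow k) ⟩
  n ^ e * (w k ^ e * n)          ≡⟨ *-assoc (n ^ e) (w k ^ e) n ⟨
  n ^ e * w k ^ e * n            ≡⟨ cong (_* n) (^-distribʳ-* n (w k) e) ⟨
  (n * w k) ^ e * n              ≤⟨ *-monoˡ-≤ n (^-monoˡ-≤ e (grow k)) ⟩
  (w (suc k) * w (suc k)) ^ e * n ≡⟨ cong (_* n) (^-distribʳ-* (w (suc k)) (w (suc k)) e) ⟩
  w (suc k) ^ e * w (suc k) ^ e * n ≡⟨ cong (_* n) (^-double (w (suc k)) e) ⟨
  w (suc k) ^ (2 * e) * n        ∎
  where
  open ≤-Reasoning
  e = 2 ^ k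

-- If `w + w ≤ n`, multiplying `large` by `2 ^ e` gives `n ^ e * 2 ^ e ≤ n ^ e * n`, and cancelling
-- `n ^ e` contradicts `n < 2 ^ e`.
more-than-half : ∀ n w e .{{_ : NonZero n}} → n ^ e ≤ w ^ e * n → n < 2 ^ e → n < w + w
more-than-half n w e large n<2^e = ≰⇒> λ 2w≤n → <⇒≱ n<2^e
  (*-cancelˡ-≤ (n ^ e) {{m^n≢0 n e}} (begin
    n ^ e * 2 ^ e        ≤⟨ *-monoˡ-≤ (2 ^ e) large ⟩
    w ^ e * n * 2 ^ e    ≡⟨ *-comm (w ^ e * n) (2 ^ e) ⟩
    2 ^ e * (w ^ e * n)  ≡⟨ *-assoc (2 ^ e) (w ^ e) n ⟨
    2 ^ e * w ^ e * n    ≡⟨ cong (_* n) (^-distribʳ-* 2 w e) ⟨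
    (2 * w) ^ e * n      ≡⟨ cong (λ x → (w + x) ^ e * n) (+-identityʳ w) ⟩
    (w + w) ^ e * n      ≤⟨ *-monoˡ-≤ n (^-monoˡ-≤ e 2w≤n) ⟩
    n ^ e * n            ∎))
  where open ≤-Reasoning

module Growth {Ω : Set} {n : ℕ} {enum : Ω ↔ Fin n} (𝔛 : Scheme enum) .{{_ : NonZero n}} where

  open Enumerated enum
  open Invariance 𝔛

  walks-cover : {b : Rel Ω 0ℓ} → Decidable b → Invariant b →
                ∀ D → (∀ α β → (Walk b D ⨾ (Walk b D *ᵣ)) α β) →
                ∀ k → n < 2 ^ (2 ^ k) → ∀ α β → Walk b (k * D + k * D) α β
  walks-cover {b} b? b-inv D complete k n<2^2^k α β =
    let γ , αγ , γβ = pigeonhole (W? k) (out k) (inn k)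
          (more-than-half n (w k) (2 ^ k) (square-growth n w w₀>0 grow k) n<2^2^k) α β
    in walk-++ (k * D) αγ γβ
    where
    W? : ∀ k → Decidable (Walk b (k * D))
    W? k = Walk? b? (k * D)

    w : ℕ → ℕ
    w k = degree (W? k) α

    out : ∀ k → Regular (W? k) (w k)
    out k = invariant-regular (W? k) (Walk-invariant b-inv (k * D)) α

    inn : ∀ k → Regular (flip (W? k)) (w k)
    inn k = invariant-regular-flip (W? k) (Walk-invariant b-inv (k * D)) α

    grow : ∀ k → n * w k ≤ w (suc k) * w (suc k)
    -- `E` consists of the walks of `suc k * D` steps and `F` is its transpose: putting `D` steps in
    -- front of `k * D` steps gives both inclusions. In- and out-degrees agree, so the bound is a
    -- square.
    grow k = ruzsa {A = Walk b D} {C = Walk b D *ᵣ} (W? k) (W? (suc k)) (flip (W? (suc k)))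
      (out k) (out (suc k)) (inn (suc k)) complete
      (λ (_ , u , v) → walk-++ D u v) (λ (_ , v , u) → walk-++ D u v) α

    w₀>0 : w 0 > 0
    w₀>0 = subst (0 <_) (card≡∑Ω (W? 0 α)) (card-positive (W? 0 α) (α , refl))

-- Iterated logarithms

n<2^n : ∀ n → n < 2 ^ n
n<2^n zero    = s≤s z≤n
n<2^n (suc n) = begin-strict
  1 + n            <⟨ +-mono-≤-< (m^n>0 2 n) (n<2^n n) ⟩
  2 ^ n + 2 ^ n    ≡⟨ cong (2 ^ n +_) (+-identityʳ (2 ^ n)) ⟨
  2 ^ suc n        ∎
  where open ≤-Reasoning

-- The second bound is 2.9 ^ (2 ^ j) < n.  As 2 ^ 1.5 < 2.9, it makes
-- 1.5 * 2 ^ j smaller than log₂ n; at j = 0 it holds already for n = 3.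
loglog-scale : ∀ n → n ≥ 3 →
               ∃ λ j → n < 2 ^ (2 ^ (2 + j)) × 29 ^ (2 ^ j) < n * 10 ^ (2 ^ j)
loglog-scale n n≥3
  -- The search is bounded by the crude estimate `n < 2 ^ (2 ^ (2 + n))`.
  with least (λ j → n <? 2 ^ (2 ^ (2 + j))) n
    (<-trans (n<2^n n) (^-monoʳ-< 2 (s≤s (s≤s z≤n))
      (<-trans (n<2^n n) (^-monoʳ-< 2 (s≤s (s≤s z≤n)) (m<n+m n {2} (s≤s z≤n))))))
... | zero  , upper , _ = 0 , upper , *-monoˡ-≤ 10 n≥3
-- By minimality index `i` fails, so `4 ^ m = 2 ^ (2 * m)` is at most `n`, and `2.9 < 4`.
... | suc i , upper , j-least = suc i , upper , (begin-strict
  29 ^ m             <⟨ ^-monoˡ-< m {{m≢0}} (m≤m+n 30 10) ⟩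
  (4 * 10) ^ m       ≡⟨ ^-distribʳ-* 4 10 m ⟩
  4 ^ m * 10 ^ m     ≡⟨ cong (_* 10 ^ m) (^-*-assoc 2 2 m) ⟩
  2 ^ (2 * m) * 10 ^ m ≤⟨ *-monoˡ-≤ (10 ^ m) (≮⇒≥ (λ n< → 1+n≰n (j-least i n<))) ⟩
  n * 10 ^ m         ∎)
  where
  open ≤-Reasoning
  m = 2 ^ suc i
  m≢0 = m^n≢0 2 (suc i)

x≤x^4 : ∀ x .{{_ : NonZero x}} → x ≤ x ^ 4
x≤x^4 x = m≤m*n x (x ^ 3) {{m^n≢0 x 3}}

-- With m = 2 ^ j the witnesses are 3m/2 < log₂ n and (29/10) ^ m < n.
log₂log₂-lower : ∀ n j → 29 ^ (2 ^ j) < n * 10 ^ (2 ^ j) →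
                 ∀ p q → 4 * p < (2 + j) * q → log₂ (log₂ (fromℕ n)) p q
log₂log₂-lower n j 29^m<n*10^m p q 4p<[2+j]q =
  3 * m , 2 , s≤s z≤n ,
  (29 ^ m , 10 ^ m , m^n>0 10 m , 29^m<n*10^m , inner) ,
  -- The last condition is compared in fourth powers, to match the `4 * p` of the hypothesis. Its
  -- factor `2 ^ q` comes from the denominator of `3 * m / 2` and accounts for the extra `4 * q` in
  -- `exponent`.
  ≰⇒> (λ le → <⇒≱ outer (^-monoˡ-≤ 4 le))
  where
  open ≤-Reasoning
  m = 2 ^ j
  m≢0 = m^n≢0 2 j

  inner : 2 ^ (3 * m) * (10 ^ m) ^ 2 < (29 ^ m) ^ 2
  inner = begin-strict
    2 ^ (3 * m) * (10 ^ m) ^ 2   ≡⟨ cong₂ _*_ (sym (^-*-assoc 2 3 m)) (^-*-assoc 10 m 2) ⟩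
    8 ^ m * 10 ^ (m * 2)         ≡⟨ cong (λ e → 8 ^ m * 10 ^ e) (*-comm m 2) ⟩
    8 ^ m * 10 ^ (2 * m)         ≡⟨ cong (8 ^ m *_) (^-*-assoc 10 2 m) ⟨
    8 ^ m * 100 ^ m              ≡⟨ ^-distribʳ-* 8 100 m ⟨
    -- This is `2 ^ 3 * 10 ^ 2 < 29 ^ 2`, the square of `2 ^ 1.5 < 2.9` with denominators cleared.
    800 ^ m                      <⟨ ^-monoˡ-< m {{m≢0}} (m≤m+n 801 40) ⟩
    841 ^ m                      ≡⟨ ^-*-assoc 29 2 m ⟩
    29 ^ (2 * m)                 ≡⟨ cong (29 ^_) (*-comm 2 m) ⟩
    29 ^ (m * 2)                 ≡⟨ ^-*-assoc 29 m 2 ⟨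
    (29 ^ m) ^ 2                 ∎

  exponent : (p + q) * 4 < (6 + j) * q
  exponent = begin-strict
    (p + q) * 4        ≡⟨ *-comm (p + q) 4 ⟩
    4 * (p + q)        ≡⟨ *-distribˡ-+ 4 p q ⟩
    4 * p + 4 * q      <⟨ +-monoˡ-< (4 * q) 4p<[2+j]q ⟩
    (2 + j) * q + 4 * q ≡⟨ +-comm ((2 + j) * q) (4 * q) ⟩
    4 * q + (2 + j) * q ≡⟨ *-distribʳ-+ q 4 (2 + j) ⟨
    (6 + j) * q        ∎

  outer : (2 ^ p * 2 ^ q) ^ 4 < ((3 * m) ^ q) ^ 4
  outer = begin-strict
    (2 ^ p * 2 ^ q) ^ 4   ≡⟨ cong (_^ 4) (^-distribˡ-+-* 2 p q) ⟨
    (2 ^ (p + q)) ^ 4     ≡⟨ ^-*-assoc 2 (p + q) 4 ⟩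
    2 ^ ((p + q) * 4)     <⟨ ^-monoʳ-< 2 (s≤s (s≤s z≤n)) exponent ⟩
    2 ^ ((6 + j) * q)     ≡⟨ ^-*-assoc 2 (6 + j) q ⟨
    (2 ^ (6 + j)) ^ q     ≡⟨ cong (_^ q) (^-distribˡ-+-* 2 6 j) ⟩
    -- `2 ^ 6 ≤ 3 ^ 4` is what lets the numerator `3 * m` absorb the exponent `6 + j`.
    (64 * m) ^ q          ≤⟨ ^-monoˡ-≤ q (*-mono-≤ (m≤m+n 64 17) (x≤x^4 m {{m≢0}})) ⟩
    (81 * m ^ 4) ^ q      ≡⟨ cong (_^ q) (^-distribʳ-* 3 m 4) ⟨
    ((3 * m) ^ 4) ^ q     ≡⟨ ^-*-assoc (3 * m) 4 q ⟩
    (3 * m) ^ (4 * q)     ≡⟨ cong ((3 * m) ^_) (*-comm 4 q) ⟩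
    (3 * m) ^ (q * 4)     ≡⟨ ^-*-assoc (3 * m) q 4 ⟨
    ((3 * m) ^ q) ^ 4     ∎

-- `log₂log₂-lower` says that the double logarithm is at least `(2 + j) / 4`. The constant `8` is
-- the product of this `4` and the `2` in `d ≤ 2 * (2 + j) * D`.
loglog-bound : ∀ n j → 29 ^ (2 ^ j) < n * 10 ^ (2 ^ j) →
               ∀ d D → d ≤ (2 + j) * D + (2 + j) * D → d ≤ (8 * D) · log₂ (log₂ (fromℕ n))
loglog-bound n j large d D d≤2kD p q _ 8Dp<dq =
  log₂log₂-lower n j large p q (*-cancelˡ-< (2 * D) (4 * p) ((2 + j) * q) (begin-strict
    2 * D * (4 * p)
      ≡⟨ solve 2 (λ D p → con 2 :* D :* (con 4 :* p) := con 8 :* D :* p) refl D p ⟩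
    8 * D * p                            <⟨ 8Dp<dq ⟩
    d * q                                ≤⟨ *-monoˡ-≤ q d≤2kD ⟩
    ((2 + j) * D + (2 + j) * D) * q
      ≡⟨ solve 3 (λ k D q → (k :* D :+ k :* D) :* q := con 2 :* D :* (k :* q)) refl (2 + j) D q ⟩
    2 * D * ((2 + j) * q)                ∎))
  where
  open ≤-Reasoning
  open +-*-Solver

-- Bounding the directed diameter

directedDiameter-≤ : {Ω : Set} {a : Rel Ω 0ℓ} {d m : ℕ} → IsDirectedDiameter a d →
                     (∀ α β → ∃ λ l → l ≤ m × Walk a l α β) → d ≤ m
directedDiameter-≤ (_ , α , β , _ , d-least) walks with l , l≤m , w ← walks α β =
  ≤-trans (d-least l w) l≤m

module _ {Ω : Set} {n : ℕ} {enum : Ω ↔ Fin n} (𝔛 : Scheme enum) .{{_ : NonZero n}} where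

  open Enumerated enum
  open Invariance 𝔛
  open Growth 𝔛

  -- The growth argument runs in the reflexive closure of `a`: shortest undirected walks split into
  -- two directed ones, which loops pad to the common length `D`. The loops are dropped again from
  -- the resulting walks.
  directed-walks : {a : Rel Ω 0ℓ} → a ∈∪ 𝔛 → ((a *ᵣ) ⨾ a) ⇒ (a ⨾ (a *ᵣ)) →
                   ∀ {D} → IsDiameter a D → ∀ k → n < 2 ^ (2 ^ k) →
                   ∀ α β → ∃ λ l → l ≤ k * D + k * D × Walk a l α β
  directed-walks {a} a∈S comm {D} (distances , _) k n<2^2^k α β =
    walk-unpad (k * D + k * D) (walks-cover
      (λ α β → ∈∪-decidable a∈S α β ⊎-dec (α ≟Ω β))
      (∪-invariant (∈∪-invariant a∈S) ≡-invariant)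
      D complete k n<2^2^k α β)
    where
    complete : ∀ α β → (Walk (a ∪ _≡_) D ⨾ (Walk (a ∪ _≡_) D *ᵣ)) α β
    complete α β with i , (w , _) , i≤D ← distances α β
      with γ , u , v ← undirected-walk-splits comm i w =
      γ , walk-pad i≤D u , walk-pad i≤D v

proposition3p4 : ∃ λ (C : ℕ) → C > 0 ×
    (∀ (n : ℕ) → n ≥ 3 →
    ∀ (Ω : Set) (enum : Ω ↔ Fin n) (𝔛 : Scheme enum) (a : Rel Ω 0ℓ) →
    a ∈∪ 𝔛 → Connected a → (a ⨾ (a *ᵣ)) ⇔ ((a *ᵣ) ⨾ a) →
    ∃₂ λ (d D : ℕ) → IsDirectedDiameter a d × IsDiameter a D ×
    d ≤ (C * D) · log₂ (log₂ (fromℕ n)))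
proposition3p4 = 8 , s≤s z≤n , λ { n@(suc _) n≥3 Ω enum 𝔛 a a∈S connected (_ , comm) →
  let a? = Invariance.∈∪-decidable 𝔛 a∈S
      D , D-diameter = directedDiameter enum (λ α β → a? α β ⊎-dec a? β α)
        (λ α β → EqClosure⇒Walk (connected α β))
      j , n<2^2^k , large = loglog-scale n n≥3
      -- Strong connectivity comes out of the growth argument: these walks make the directed
      -- distances finite and also bound their maximum.
      walks = directed-walks 𝔛 a∈S comm D-diameter (2 + j) n<2^2^k
      d , d-diameter = directedDiameter enum a?
        (λ α β → let l , _ , w = walks α β in l , w)
  in d , D , d-diameter , D-diameter ,
     loglog-bound n j large d D (directedDiameter-≤ d-diameter walks) }
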